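{- Let $X$ be a finite set of variables, $(A,\_[\_/\_])$ a renset, and $\mathsf{Vr}^{\mathcal{A}} : \mathsf{Var}\to A$, $\mathsf{Ap}^{\mathcal{A}} : A\to A\to A$, $\mathsf{Lm}^{\mathcal{A}} : \mathsf{Var}\to A\to A$ some functions such that the following hold for all $a,a_1,a_2\in A$ and all $x,y,z\in\mathsf{Var}$ with $x,y,z\notin X$: - (S1) $(\mathsf{Vr}^{\mathcal{A}}\,x)[y/z] = \mathsf{Vr}^{\mathcal{A}}(x[y/z])$; - (S2) $(\mathsf{Ap}^{\mathcal{A}}\,a_1\,a_2)[y/z] = \mathsf{Ap}^{\mathcal{A}}\,(a_1[y/z])\,(a_2[y/z])$; - (S3) if $x \notin \{y,z\}$ then $(\mathsf{Lm}^{\mathcal{A}}\,x\,a)[y/z] = \mathsf{Lm}^{\mathcal{A}}\,x\,(a[y/z])$; - (S4) $(\mathsf{Lm}^{\mathcal{A}}\,x\,a)[y/x] = \mathsf{Lm}^{\mathcal{A}}\,x\,a$; - (S5) if $z\neq y$ then $\mathsf{Lm}^{\mathcal{A}}\,x\,(a[z/y]) = \mathsf{Lm}^{\mathcal{A}}\,y\,(a[z/y][y/x])$. Then there exists a unique function $f : \mathsf{Trm}\to A$ such that the following hold for all $x,y,z\in\mathsf{Var}$ and $t,t_1,t_2\in\mathsf{Trm}$: (i) $f(\mathsf{Vr}\,x) = \mathsf{Vr}^{\mathcal{A}}\,x$; (ii) $f(\mathsf{Ap}\,t_1\,t_2) = \mathsf{Ap}^{\mathcal{A}}\,(f\,t_1)\,(f\,t_2)$;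 (iii) $f(\mathsf{Lm}\,x\,t) = \mathsf{Lm}^{\mathcal{A}}\,x\,(f\,t)$ if $x\notin X$; (iv) $f(t[y/z]) = (f\,t)[y/z]$ if $y,z\notin X$.
   Context: $\mathsf{Var}$ is a fixed countably infinite set (of variables). $\mathsf{Trm}$ is the set of (untyped) $\lambda$-terms generated by the grammar $t ::= \mathsf{Vr}\,x \mid \mathsf{Ap}\,t_1\,t_2 \mid \mathsf{Lm}\,x\,t$ (with $x \in \mathsf{Var}$), where terms are identified modulo alpha-equivalence (i.e., the quotient of the freely generated pre-terms by alpha-equivalence). The constructors, lifted to the quotient, are $\mathsf{Vr} : \mathsf{Var} \to \mathsf{Trm}$, $\mathsf{Ap} : \mathsf{Trm}\to\mathsf{Trm}\to\mathsf{Trm}$, $\mathsf{Lm} : \mathsf{Var} \to \mathsf{Trm}\to\mathsf{Trm}$. Renaming $t[y/x]$ on terms is the standard capture-avoiding substitution of the variable $y$ for the free occurrences of the variable $x$ in $t$. On variables, $x[y/z]$ is $y$ if $x=z$ and $x$ otherwise. A renaming-enriched set (renset) is a pair $(A, \_[\_/\_])$ where $A$ is a set and $\_[\_/\_] : A \to \mathsf{Var} \to \mathsf{Var} \to A$ is an operator such that for all $x, x_1, x_2, x_3, y, y_1, y_2 \in \mathsf{Var}$ and $a \in A$: - Identity: $a[x/x] = a$; - Idempotence: if $x_1 \neq y$ then $a[x_1/y][x_2/y] = a[x_1/y]$; - Chaining: if $y \neq x_2$ then $a[y/x_2][x_2/x_1][x_3/x_2] = a[y/x_2][x_3/x_1]$;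 - Commutativity: if $x_2 \neq y_1$, $y_1 \neq x_1$ and $x_1 \neq y_2$ then $a[x_2/x_1][y_2/y_1] = a[y_2/y_1][x_2/x_1]$.
   Formalization: (S1) is required for all variables x, including x in X, with only y,z outside X; with x also restricted the claim fails, and the added instances, Vr^A x [y/z] = Vr^A x for x in X, are forced by (i) and (iv). -}

module Defs where

open import Level using (Level; suc; _⊔_)
open import Data.Bool.Base using (if_then_else_)
open import Data.List.Base using (List; []; _∷_; _++_; map; filter)
open import Data.List.Extrema.Nat using (max; xs≤max)
open import Data.List.Membership.Propositional using (_∈_; _∉_)
open import Data.List.Membership.Propositional.Properties using (∈-map⁺)
open import Data.List.Relation.Unary.All using () renaming (lookup to All-lookup)
open import Data.Nat.Base as ℕ using (ℕ)
open import Data.Nat.Properties using (1+n≰n) renaming (_≟_ to _≟ℕ_)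
open import Function.Base using (_∘_)
open import Function.Bundles using (Func; _⟨$⟩_; _↔_; Inverse)
open import Function.Properties.Inverse using (↔⇒↣)
open import Relation.Binary.Bundles using (Setoid)
open import Relation.Binary.Definitions using (DecidableEquality)
open import Relation.Binary.PropositionalEquality using (_≡_; _≢_; subst; sym)
open import Relation.Nullary.Decidable.Core using (does; ¬?)
open import Relation.Nullary.Decidable using (via-injection)

-- Everything is relative to a countably infinite set Var of variables.

module Syntax (Var : Set) (enum : Var ↔ ℕ) where

  open Inverse enum using (to; from; strictlyInverseˡ)

  infix 4 _≟_
  _≟_ : DecidableEquality Var
  _≟_ = via-injection (↔⇒↣ enum) _≟ℕ_

  -- The choice of fresh variable is arbitrary; only fresh-∉ matters.
  fresh : List Var → Var
  fresh xs = from (ℕ.suc (max 0 (map to xs)))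

  fresh-∉ : ∀ xs → fresh xs ∉ xs
  fresh-∉ xs x∈xs = 1+n≰n (subst (ℕ._≤ max 0 (map to xs)) (strictlyInverseˡ _)
    (All-lookup (xs≤max 0 (map to xs)) (∈-map⁺ to x∈xs)))

  infixl 9 _[_/_]ᵛ _[_/_]ᵗ

  _[_/_]ᵛ : Var → Var → Var → Var
  x [ y / z ]ᵛ = if does (x ≟ z) then y else x

  data PTrm : Set where
    Vr : Var → PTrm
    Ap : PTrm → PTrm → PTrm
    Lm : Var → PTrm → PTrm

  fv : PTrm → List Var
  fv (Vr x)     = x ∷ []
  fv (Ap t₁ t₂) = fv t₁ ++ fv t₂
  fv (Lm x t)   = filter (λ y → ¬? (y ≟ x)) (fv t)

  _[_↦_] : (Var → Var) → Var → Var → (Var → Var)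
  (ρ [ x ↦ w ]) v = if does (v ≟ x) then w else ρ v

  -- Simultaneous capture-avoiding renaming of all free variables along ρ.
  -- Every binder is replaced by a variable that cannot capture; carrying the
  -- replacement in ρ keeps the recursion structural, which it would not be for
  -- single renaming t[y/x], where the body is renamed twice.
  rename : (Var → Var) → PTrm → PTrm
  rename ρ (Vr x)     = Vr (ρ x)
  rename ρ (Ap t₁ t₂) = Ap (rename ρ t₁) (rename ρ t₂)
  rename ρ (Lm x t)   = Lm w (rename (ρ [ x ↦ w ]) t)
    where
    w : Var
    w = fresh (map ρ (fv (Lm x t)))

  _[_/_]ᵗ : PTrm → Var → Var → PTrm
  t [ y / x ]ᵗ = rename (_[ y / x ]ᵛ) t

  infix 4 _≈α_

  -- The least congruence containing renaming of bound variables.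
  data _≈α_ : PTrm → PTrm → Set where
    α-refl  : ∀ {t} → t ≈α t
    α-sym   : ∀ {s t} → s ≈α t → t ≈α s
    α-trans : ∀ {s t u} → s ≈α t → t ≈α u → s ≈α u
    α-Ap    : ∀ {s₁ s₂ t₁ t₂} → s₁ ≈α t₁ → s₂ ≈α t₂ → Ap s₁ s₂ ≈α Ap t₁ t₂
    α-Lm    : ∀ {x s t} → s ≈α t → Lm x s ≈α Lm x t
    α-conv  : ∀ {x y t} → y ∉ fv t → Lm x t ≈α Lm y (t [ y / x ]ᵗ)

  -- The quotient of pre-terms by α-equivalence, as a setoid.
  Trm : Setoid _ _
  Trm = record
    { Carrier       = PTrm
    ; _≈_           = _≈α_
    ; isEquivalence = record { refl = α-refl ; sym = α-sym ; trans = α-trans }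
    }

  -- Since terms form a setoid, all carriers are setoids; a plain set is the
  -- special case of propositional equality.
  record Renset (c ℓ : Level) : Set (suc (c ⊔ ℓ)) where
    infixl 9 _[_/_]
    field
      setoid : Setoid c ℓ
    open Setoid setoid public
    field
      _[_/_]        : Carrier → Var → Var → Carrier
      []-cong       : ∀ {a b} x y → a ≈ b → a [ x / y ] ≈ b [ x / y ]
      identity      : ∀ a x → a [ x / x ] ≈ a
      idempotence   : ∀ a {x₁ x₂ y} → x₁ ≢ y →
                      a [ x₁ / y ] [ x₂ / y ] ≈ a [ x₁ / y ]
      chaining      : ∀ a {x₁ x₂ x₃ y} → y ≢ x₂ →
                      a [ y / x₂ ] [ x₂ / x₁ ] [ x₃ / x₂ ] ≈ a [ y / x₂ ] [ x₃ / x₁ ]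
      commutativity : ∀ a {x₁ x₂ y₁ y₂} → x₂ ≢ y₁ → y₁ ≢ x₁ → x₁ ≢ y₂ →
                      a [ x₂ / x₁ ] [ y₂ / y₁ ] ≈ a [ y₂ / y₁ ] [ x₂ / x₁ ]

  module _ {c ℓ : Level} (𝓐 : Renset c ℓ) where

    open Renset 𝓐

    record Operations : Set (c ⊔ ℓ) where
      field
        Vrᴬ      : Var → Carrier
        Apᴬ      : Carrier → Carrier → Carrier
        Lmᴬ      : Var → Carrier → Carrier
        Apᴬ-cong : ∀ {a₁ a₂ b₁ b₂} → a₁ ≈ b₁ → a₂ ≈ b₂ → Apᴬ a₁ a₂ ≈ Apᴬ b₁ b₂
        Lmᴬ-cong : ∀ {a b} x → a ≈ b → Lmᴬ x a ≈ Lmᴬ x b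

    -- X is a finite set of variables, given by a list of its elements.
    module _ (X : List Var) (ops : Operations) where

      open Operations ops

      -- S1 deliberately departs from the published clause, which also assumes
      -- x ∉ X: with that restriction no recursor need exist.  Suppose x ∈ X,
      -- y, z ∉ X and Vrᴬ x ≈ Vrᴬ z, but not Vrᴬ y ≈ Vrᴬ z (nothing in the
      -- restricted clause excludes this).  Then f (Vr x [ y / z ]ᵗ) ≈ Vrᴬ z,
      -- whereas f (Vr x) [ y / z ] ≈ Vrᴬ z [ y / z ] ≈ Vrᴬ y.
      -- The instances added here, Vrᴬ x [ y / z ] ≈ Vrᴬ x for x ∈ X, are forced
      -- by Vr-rec and rename-rec below, so they are also necessary.
      record Clauses : Set (c ⊔ ℓ) where
        field
          S1 : ∀ {x y z} → y ∉ X → z ∉ X →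
               Vrᴬ x [ y / z ] ≈ Vrᴬ (x [ y / z ]ᵛ)
          S2 : ∀ {a₁ a₂ y z} → y ∉ X → z ∉ X →
               Apᴬ a₁ a₂ [ y / z ] ≈ Apᴬ (a₁ [ y / z ]) (a₂ [ y / z ])
          S3 : ∀ {a x y z} → x ∉ X → y ∉ X → z ∉ X → x ≢ y → x ≢ z →
               Lmᴬ x a [ y / z ] ≈ Lmᴬ x (a [ y / z ])
          S4 : ∀ {a x y} → x ∉ X → y ∉ X →
               Lmᴬ x a [ y / x ] ≈ Lmᴬ x a
          S5 : ∀ {a x y z} → x ∉ X → y ∉ X → z ∉ X → z ≢ y →
               Lmᴬ x (a [ z / y ]) ≈ Lmᴬ y (a [ z / y ] [ y / x ])

      record IsRecursor (f : Func Trm setoid) : Set ℓ where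
        field
          Vr-rec     : ∀ x → f ⟨$⟩ Vr x ≈ Vrᴬ x
          Ap-rec     : ∀ t₁ t₂ → f ⟨$⟩ Ap t₁ t₂ ≈ Apᴬ (f ⟨$⟩ t₁) (f ⟨$⟩ t₂)
          Lm-rec     : ∀ {x} t → x ∉ X → f ⟨$⟩ Lm x t ≈ Lmᴬ x (f ⟨$⟩ t)
          rename-rec : ∀ {y z} t → y ∉ X → z ∉ X →
                       f ⟨$⟩ (t [ y / z ]ᵗ) ≈ (f ⟨$⟩ t) [ y / z ]

{-# OPTIONS --safe #-}

-- A term is evaluated under an environment ρ that renames its free variables,
-- and every binder is replaced by a variable fresh for X and for the image of ρ.
-- By S5 the choice of that variable is immaterial, so evaluation commutes with
-- renaming and is invariant under α.  Uniqueness is by induction on depth: up to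
-- α, every abstraction has a bound variable outside X.

module Submission where

open import Defs
open import Data.Bool.Base using (if_then_else_)
open import Data.List.Base using (List; _∷_; _++_; map)
open import Data.List.Membership.Propositional using (_∈_; _∉_)
open import Data.List.Membership.Propositional.Properties
  using (∈-map⁺; ∈-++⁺ˡ; ∈-++⁺ʳ; ∈-filter⁺; ∈-filter⁻)
open import Data.List.Properties using (map-cong-local; map-id)
open import Data.List.Relation.Unary.All as All using ()
open import Data.List.Relation.Unary.Any using (here; there)
open import Data.Nat.Base using (ℕ; suc; _⊔_; _≤_; s≤s)
open import Data.Nat.Properties using (≤-refl; ≤-trans; ≤-reflexive; m≤m⊔n; m≤n⊔m)
open import Data.Product using (∃!; _,_; proj₂)
open import Function.Base using (_∘_; id)
open import Function.Bundles using (Func; _⟨$⟩_; _↔_)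
open import Function.Relation.Binary.Setoid.Equality using () renaming (_≈_ to Pointwise)
open import Relation.Binary.PropositionalEquality
  using (_≡_; _≢_; refl; sym; trans; cong; cong₂; subst)
import Relation.Binary.Reasoning.Setoid as SetoidReasoning
open import Relation.Nullary using (yes; no)
open import Relation.Nullary.Decidable using (dec-true; dec-false; ¬?)

∉-map⇒≢ : ∀ {A B : Set} {f : A → B} {xs w} → w ∉ map f xs →
          ∀ {v} → v ∈ xs → f v ≢ w
∉-map⇒≢ {f = f} w∉ v∈ refl = w∉ (∈-map⁺ f v∈)

module Recursion (Var : Set) (enum : Var ↔ ℕ) where

  open Syntax Var enum

  -- Environments, free variables and depth

  update-≡ : ∀ ρ x w → (ρ [ x ↦ w ]) x ≡ w
  update-≡ ρ x w = cong (if_then w else ρ x) (dec-true (x ≟ x) refl)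

  update-≢ : ∀ ρ {x w v} → v ≢ x → (ρ [ x ↦ w ]) v ≡ ρ v
  update-≢ ρ {x} {w} {v} v≢x = cong (if_then w else ρ v) (dec-false (v ≟ x) v≢x)

  ∈-fv-Lm⁺ : ∀ {x v} t → v ∈ fv t → v ≢ x → v ∈ fv (Lm x t)
  ∈-fv-Lm⁺ {x} t = ∈-filter⁺ (λ y → ¬? (y ≟ x))

  ∉-fv-Lm : ∀ x t → x ∉ fv (Lm x t)
  ∉-fv-Lm x t x∈ = proj₂ (∈-filter⁻ (λ y → ¬? (y ≟ x)) {xs = fv t} x∈) refl

  -- Every comparison of environments under a binder goes through this criterion. Membership in
  -- `fv (Lm x t)` is handed to the premise because freshness of binders is measured against the
  -- image of that list.
  update-unique : ∀ {τ σ : Var → Var} {x w} t → τ x ≡ w →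
                  (∀ {v} → v ∈ fv t → v ≢ x → v ∈ fv (Lm x t) → τ v ≡ σ v) →
                  ∀ {v} → v ∈ fv t → τ v ≡ (σ [ x ↦ w ]) v
  update-unique {σ = σ} {x} {w} t τx≡w τ≡σ {v} v∈ with v ≟ x
  ... | yes refl = trans τx≡w (sym (update-≡ σ x w))
  ... | no v≢x   = trans (τ≡σ v∈ v≢x (∈-fv-Lm⁺ t v∈ v≢x)) (sym (update-≢ σ v≢x))

  depth : PTrm → ℕ
  depth (Vr x)     = 0
  depth (Ap t₁ t₂) = suc (depth t₁ ⊔ depth t₂)
  depth (Lm x t)   = suc (depth t)

  depth-rename : ∀ ρ t → depth (rename ρ t) ≡ depth t
  depth-rename ρ (Vr x)     = refl
  depth-rename ρ (Ap t₁ t₂) =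
    cong suc (cong₂ _⊔_ (depth-rename ρ t₁) (depth-rename ρ t₂))
  depth-rename ρ (Lm x t)   = cong suc (depth-rename _ t)

  module _ {c ℓ} (X : List Var) (𝓐 : Renset c ℓ) (ops : Operations 𝓐)
           (clauses : Clauses 𝓐 X ops) where

    open Renset 𝓐 renaming
      (refl to ≈-refl; sym to ≈-sym; trans to ≈-trans; reflexive to ≈-reflexive)
    open Operations ops
    open Clauses clauses
    open SetoidReasoning setoid

    -- Evaluation, renaming and α-equivalence

    binder : (Var → Var) → Var → PTrm → Var
    binder ρ x t = fresh (X ++ map ρ (fv (Lm x t)))

    eval : (Var → Var) → PTrm → Carrier
    eval ρ (Vr x)     = Vrᴬ (ρ x)
    eval ρ (Ap t₁ t₂) = Apᴬ (eval ρ t₁) (eval ρ t₂)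
    eval ρ (Lm x t)   = Lmᴬ (binder ρ x t) (eval (ρ [ x ↦ binder ρ x t ]) t)

    -- This holds up to `≡` because the binder is computed from the values of the environment on the
    -- free variables alone, so equal values select the same binder.
    eval-cong : ∀ {ρ σ} t → (∀ {v} → v ∈ fv t → ρ v ≡ σ v) → eval ρ t ≡ eval σ t
    eval-cong (Vr x) ρ≡σ     = cong Vrᴬ (ρ≡σ (here refl))
    eval-cong (Ap t₁ t₂) ρ≡σ =
      cong₂ Apᴬ (eval-cong t₁ (ρ≡σ ∘ ∈-++⁺ˡ)) (eval-cong t₂ (ρ≡σ ∘ ∈-++⁺ʳ (fv t₁)))
    eval-cong {ρ} {σ} (Lm x t) ρ≡σ = cong₂ Lmᴬ w≡w′ (eval-cong t (update-unique t
        (trans (update-≡ ρ x _) w≡w′)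
        λ _ v≢x v∈ → trans (update-≢ ρ v≢x) (ρ≡σ v∈)))
      where
      w≡w′ : binder ρ x t ≡ binder σ x t
      w≡w′ = cong (fresh ∘ (X ++_)) (map-cong-local (All.tabulate ρ≡σ))

    mutual

      -- The mutual recursion is well-founded: at `Lm x t` the change of binder by `eval-Lm` leads
      -- back to this lemma only at the body `t`.
      eval-[/] : ∀ {y z} ρ t → y ∉ X → z ∉ X →
                 eval ρ t [ y / z ] ≈ eval ((_[ y / z ]ᵛ) ∘ ρ) t
      eval-[/] ρ (Vr x) y∉X z∉X     = S1 y∉X z∉X
      eval-[/] ρ (Ap t₁ t₂) y∉X z∉X = ≈-trans (S2 y∉X z∉X)
        (Apᴬ-cong (eval-[/] ρ t₁ y∉X z∉X) (eval-[/] ρ t₂ y∉X z∉X))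
      eval-[/] {y} {z} ρ (Lm x t) y∉X z∉X = begin
        eval ρ (Lm x t) [ y / z ]                   ≈⟨ []-cong y z (eval-Lm ρ x t w∉X w∉ρ) ⟩
        Lmᴬ w (eval (ρ [ x ↦ w ]) t) [ y / z ]      ≈⟨ S3 w∉X y∉X z∉X w≢y w≢z ⟩
        Lmᴬ w (eval (ρ [ x ↦ w ]) t [ y / z ])      ≈⟨ Lmᴬ-cong w (eval-[/] _ t y∉X z∉X) ⟩
        Lmᴬ w (eval ((_[ y / z ]ᵛ) ∘ (ρ [ x ↦ w ])) t)
          ≡⟨ cong (Lmᴬ w) (eval-cong t (update-unique t
               -- `_[ y / z ]ᵛ` unfolds to the update `id [ z ↦ y ]`, so `update-≢ id` shows that it
               -- fixes `w`.
               (trans (cong (_[ y / z ]ᵛ) (update-≡ ρ x w)) (update-≢ id w≢z))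
               λ _ v≢x _ → cong (_[ y / z ]ᵛ) (update-≢ ρ v≢x))) ⟩
        Lmᴬ w (eval (((_[ y / z ]ᵛ) ∘ ρ) [ x ↦ w ]) t) ≈⟨ eval-Lm _ x t w∉X w∉ρ′ ⟨
        eval ((_[ y / z ]ᵛ) ∘ ρ) (Lm x t)           ∎
        where
        ρ-image ρ′-image avoided : List Var
        ρ-image  = map ρ (fv (Lm x t))
        ρ′-image = map ((_[ y / z ]ᵛ) ∘ ρ) (fv (Lm x t))
        -- `S3` needs `w` distinct from `y` and `z`; the two images are avoided because `w` replaces
        -- the binder both before and after the renaming.
        avoided  = y ∷ z ∷ X ++ ρ-image ++ ρ′-image

        w : Var
        w = fresh avoided

        w≢y : w ≢ y
        w≢y = fresh-∉ avoided ∘ here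

        w≢z : w ≢ z
        w≢z = fresh-∉ avoided ∘ there ∘ here

        w∉X : w ∉ X
        w∉X = fresh-∉ avoided ∘ there ∘ there ∘ ∈-++⁺ˡ

        w∉ρ : w ∉ ρ-image
        w∉ρ = fresh-∉ avoided ∘ there ∘ there ∘ ∈-++⁺ʳ X ∘ ∈-++⁺ˡ

        w∉ρ′ : w ∉ ρ′-image
        w∉ρ′ = fresh-∉ avoided ∘ there ∘ there ∘ ∈-++⁺ʳ X ∘ ∈-++⁺ʳ ρ-image

      -- Since `w′` is not a value of `ρ` on the free variables, `[ w / w′ ]` fixes the body. The
      -- body therefore has the shape that `S5` asks for, with `w` also in the role of `z`.
      Lmᴬ-rebind : ∀ {w w′} ρ x t → w ∉ X → w′ ∉ X →
                   w ∉ map ρ (fv (Lm x t)) → w′ ∉ map ρ (fv (Lm x t)) →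
                   Lmᴬ w (eval (ρ [ x ↦ w ]) t) ≈ Lmᴬ w′ (eval (ρ [ x ↦ w′ ]) t)
      Lmᴬ-rebind {w} {w′} ρ x t w∉X w′∉X w∉ρ w′∉ρ with w ≟ w′
      ... | yes refl = ≈-refl
      ... | no w≢w′  = begin
        Lmᴬ w a                            ≈⟨ Lmᴬ-cong w a[w/w′]≈a ⟨
        Lmᴬ w (a [ w / w′ ])               ≈⟨ S5 w∉X w′∉X w∉X w≢w′ ⟩
        Lmᴬ w′ (a [ w / w′ ] [ w′ / w ])   ≈⟨ Lmᴬ-cong w′ ([]-cong w′ w a[w/w′]≈a) ⟩
        Lmᴬ w′ (a [ w′ / w ])              ≈⟨ Lmᴬ-cong w′ (move w′∉X w∉X w∉ρ (update-≡ id w w′)) ⟩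
        Lmᴬ w′ (eval (ρ [ x ↦ w′ ]) t)     ∎
        where
        a : Carrier
        a = eval (ρ [ x ↦ w ]) t

        -- Because `z` misses the values of `ρ`, renaming `z` can change only the value at `x`. It
        -- is used once with `[ w / w′ ]`, which keeps that value, and once with `[ w′ / w ]`, which
        -- turns it into `w′`.
        move : ∀ {y z u} → y ∉ X → z ∉ X → z ∉ map ρ (fv (Lm x t)) →
               w [ y / z ]ᵛ ≡ u → a [ y / z ] ≈ eval (ρ [ x ↦ u ]) t
        move {y} {z} y∉X z∉X z∉ρ eq = ≈-trans (eval-[/] _ t y∉X z∉X)
          (≈-reflexive (eval-cong t (update-unique t
            (trans (cong (_[ y / z ]ᵛ) (update-≡ ρ x w)) eq)
            λ _ v≢x v∈ → trans (cong (_[ y / z ]ᵛ) (update-≢ ρ v≢x))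
                               (update-≢ id (∉-map⇒≢ z∉ρ v∈)))))

        a[w/w′]≈a : a [ w / w′ ] ≈ a
        a[w/w′]≈a = move w∉X w′∉X w′∉ρ (update-≢ id w≢w′)

      eval-Lm : ∀ {w} ρ x t → w ∉ X → w ∉ map ρ (fv (Lm x t)) →
                eval ρ (Lm x t) ≈ Lmᴬ w (eval (ρ [ x ↦ w ]) t)
      eval-Lm ρ x t w∉X w∉ρ =
        Lmᴬ-rebind ρ x t (fresh-∉ avoided ∘ ∈-++⁺ˡ) w∉X (fresh-∉ avoided ∘ ∈-++⁺ʳ X) w∉ρ
        where
        avoided : List Var
        avoided = X ++ map ρ (fv (Lm x t))

    -- Both abstractions are moved to one binder fresh for both sides. The premise ranges over all
    -- `w` so that callers need not know this choice.
    eval-Lm-≈ : ∀ ρ σ {x y} s t →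
                (∀ {w} → eval (ρ [ x ↦ w ]) s ≈ eval (σ [ y ↦ w ]) t) →
                eval ρ (Lm x s) ≈ eval σ (Lm y t)
    eval-Lm-≈ ρ σ {x} {y} s t bodies = begin
      eval ρ (Lm x s)              ≈⟨ eval-Lm ρ x s w∉X w∉ρ ⟩
      Lmᴬ w (eval (ρ [ x ↦ w ]) s) ≈⟨ Lmᴬ-cong w bodies ⟩
      Lmᴬ w (eval (σ [ y ↦ w ]) t) ≈⟨ eval-Lm σ y t w∉X w∉σ ⟨
      eval σ (Lm y t)              ∎
      where
      ρ-image σ-image avoided : List Var
      ρ-image = map ρ (fv (Lm x s))
      σ-image = map σ (fv (Lm y t))
      avoided = X ++ ρ-image ++ σ-image

      w : Var
      w = fresh avoided

      w∉X : w ∉ X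
      w∉X = fresh-∉ avoided ∘ ∈-++⁺ˡ

      w∉ρ : w ∉ ρ-image
      w∉ρ = fresh-∉ avoided ∘ ∈-++⁺ʳ X ∘ ∈-++⁺ˡ

      w∉σ : w ∉ σ-image
      w∉σ = fresh-∉ avoided ∘ ∈-++⁺ʳ X ∘ ∈-++⁺ʳ ρ-image

    eval-rename : ∀ ρ σ t → eval ρ (rename σ t) ≈ eval (ρ ∘ σ) t
    eval-rename ρ σ (Vr x)     = ≈-refl
    eval-rename ρ σ (Ap t₁ t₂) = Apᴬ-cong (eval-rename ρ σ t₁) (eval-rename ρ σ t₂)
    eval-rename ρ σ (Lm x t)   = eval-Lm-≈ ρ (ρ ∘ σ) (rename (σ [ x ↦ u ]) t) t λ {w} →
      ≈-trans (eval-rename (ρ [ u ↦ w ]) (σ [ x ↦ u ]) t)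
      (≈-reflexive (eval-cong t (update-unique t
        (trans (cong (ρ [ u ↦ w ]) (update-≡ σ x u)) (update-≡ ρ u w))
        -- The binder `u` chosen by `rename` lies outside the values of `σ`, so updating `ρ` at `u`
        -- leaves them undisturbed.
        λ _ v≢x v∈ → trans (cong (ρ [ u ↦ w ]) (update-≢ σ v≢x))
                           (update-≢ ρ (∉-map⇒≢ (fresh-∉ (map σ (fv (Lm x t)))) v∈)))))
      where
      u : Var
      u = fresh (map σ (fv (Lm x t)))

    -- The environment is arbitrary because the `α-Lm` case needs the claim for the bodies under an
    -- updated one.
    eval-α : ∀ {s t} ρ → s ≈α t → eval ρ s ≈ eval ρ t
    eval-α ρ α-refl            = ≈-refl
    eval-α ρ (α-sym t≈s)       = ≈-sym (eval-α ρ t≈s)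
    eval-α ρ (α-trans s≈t t≈u) = ≈-trans (eval-α ρ s≈t) (eval-α ρ t≈u)
    eval-α ρ (α-Ap s≈t s′≈t′)  = Apᴬ-cong (eval-α ρ s≈t) (eval-α ρ s′≈t′)
    eval-α ρ (α-Lm {x} {s} {t} s≈t) = eval-Lm-≈ ρ ρ s t λ {w} → eval-α (ρ [ x ↦ w ]) s≈t
    eval-α ρ (α-conv {x} {y} {t} y∉t) = eval-Lm-≈ ρ ρ t (t [ y / x ]ᵗ) λ {w} →
      ≈-sym (≈-trans (eval-rename (ρ [ y ↦ w ]) (_[ y / x ]ᵛ) t)
      (≈-reflexive (eval-cong t (update-unique t
        (trans (cong (ρ [ y ↦ w ]) (update-≡ id x y)) (update-≡ ρ y w))
        λ v∈t v≢x _ → trans (cong (ρ [ y ↦ w ]) (update-≢ id v≢x))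
                            (update-≢ ρ λ v≡y → y∉t (subst (_∈ fv t) v≡y v∈t))))))

    -- Existence

    recursor : Func Trm setoid
    recursor = record { to = eval id ; cong = eval-α id }

    recursor-isRecursor : IsRecursor 𝓐 X ops recursor
    recursor-isRecursor = record
      { Vr-rec     = λ _ → ≈-refl
      ; Ap-rec     = λ _ _ → ≈-refl
      -- Under `id` the variable `x` is itself an admissible binder, as it is not free in `Lm x t`,
      -- and `id [ x ↦ x ]` agrees with `id`.
      ; Lm-rec     = λ {x} t x∉X → ≈-trans
          (eval-Lm id x t x∉X (subst (x ∉_) (sym (map-id (fv (Lm x t)))) (∉-fv-Lm x t)))
          (Lmᴬ-cong x (≈-reflexive (sym (eval-cong t (update-unique t refl λ _ _ _ → refl)))))
      -- Both sides equal the evaluation of `t` under `_[ y / z ]ᵛ`.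
      ; rename-rec = λ t y∉X z∉X →
          ≈-trans (eval-rename id _ t) (≈-sym (eval-[/] id t y∉X z∉X))
      }

    -- Uniqueness

    module _ {f g : Func Trm setoid}
             (f-rec : IsRecursor 𝓐 X ops f) (g-rec : IsRecursor 𝓐 X ops g) where

      private
        module F = IsRecursor f-rec
        module G = IsRecursor g-rec

      -- The bound `n` carries the recursion: `t [ w / x ]ᵗ` need not be a subterm of `Lm x t`, but
      -- it has the depth of `t`.
      recursor-unique : ∀ n t → depth t ≤ n → f ⟨$⟩ t ≈ g ⟨$⟩ t
      recursor-unique n (Vr x) _ = ≈-trans (F.Vr-rec x) (≈-sym (G.Vr-rec x))
      recursor-unique (suc n) (Ap t₁ t₂) (s≤s d≤n) = begin
        f ⟨$⟩ Ap t₁ t₂              ≈⟨ F.Ap-rec t₁ t₂ ⟩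
        Apᴬ (f ⟨$⟩ t₁) (f ⟨$⟩ t₂)   ≈⟨ Apᴬ-cong
          (recursor-unique n t₁ (≤-trans (m≤m⊔n _ _) d≤n))
          (recursor-unique n t₂ (≤-trans (m≤n⊔m (depth t₁) _) d≤n)) ⟩
        Apᴬ (g ⟨$⟩ t₁) (g ⟨$⟩ t₂)   ≈⟨ G.Ap-rec t₁ t₂ ⟨
        g ⟨$⟩ Ap t₁ t₂              ∎
      recursor-unique (suc n) (Lm x t) (s≤s d≤n) = begin
        f ⟨$⟩ Lm x t                ≈⟨ Func.cong f Lm-α ⟩
        f ⟨$⟩ Lm w (t [ w / x ]ᵗ)   ≈⟨ F.Lm-rec _ w∉X ⟩
        Lmᴬ w (f ⟨$⟩ t [ w / x ]ᵗ)  ≈⟨ Lmᴬ-cong w (recursor-unique n _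
          (≤-trans (≤-reflexive (depth-rename _ t)) d≤n)) ⟩
        Lmᴬ w (g ⟨$⟩ t [ w / x ]ᵗ)  ≈⟨ G.Lm-rec _ w∉X ⟨
        g ⟨$⟩ Lm w (t [ w / x ]ᵗ)   ≈⟨ Func.cong g Lm-α ⟨
        g ⟨$⟩ Lm x t                ∎
        where
        w : Var
        -- Avoiding `X` makes `Lm-rec` applicable; avoiding `fv t` is the side condition of
        -- `α-conv`.
        w = fresh (X ++ fv t)

        w∉X : w ∉ X
        w∉X = fresh-∉ (X ++ fv t) ∘ ∈-++⁺ˡ

        Lm-α : Lm x t ≈α Lm w (t [ w / x ]ᵗ)
        Lm-α = α-conv (fresh-∉ (X ++ fv t) ∘ ∈-++⁺ʳ X)

theorem11 : ∀ {c ℓ} (Var : Set) (enum : Var ↔ ℕ) →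
    let open Syntax Var enum in
    (X : List Var) (𝓐 : Renset c ℓ) (ops : Operations 𝓐) →
    Clauses 𝓐 X ops →
    ∃! (Pointwise Trm (Renset.setoid 𝓐)) (IsRecursor 𝓐 X ops)
theorem11 Var enum X 𝓐 ops clauses =
  recursor X 𝓐 ops clauses , is-recursor ,
  λ g-rec t → recursor-unique X 𝓐 ops clauses is-recursor g-rec _ t ≤-refl
  where
  open Recursion Var enum
  is-recursor = recursor-isRecursor X 𝓐 ops clauses
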